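{- There are universal constants $c_1,c_2>0$ such that for every randomized algorithm $\mathrm{alg}$ with running time $X$, if $\mathrm{alg}$ has profile $(1/p,\tau)$, then the expected running time $\mathcal{O}$ of the optimal simulation of $\mathrm{alg}$ satisfies $$c_1\,\frac{\tau}{p}\le\mathcal{O}\le c_2\,\frac{\tau}{p},$$ i.e. $\mathcal{O}=\Theta(R(\tau))=\Theta(\tau/p)$.
   Context: A randomized (Las Vegas) algorithm $\mathrm{alg}$ is represented by its running time $X$, a random variable with values in $[1,+\infty]$ (one second is the minimal running time; the value $+\infty$ means that the run never stops) with $\mathbb{P}[X<\infty]>0$. $\mathcal{O}$ denotes the optimal (minimal) expected running time of a simulation of $\mathrm{alg}$, where a simulation repeatedly runs $\mathrm{alg}$ with fresh independent randomness, each run killed when it exceeds its time threshold, until some run stops naturally within its threshold. The optimum is attained by repeating one fixed threshold, so that $\mathcal{O}=\inf_{t} f(t)$, where $f(t)=\mathbb{E}[X\mid X\le t]+\frac{\mathbb{P}[X>t]}{\mathbb{P}[X\le t]}\,t$ is the expected running time when the threshold $t$ is used repeatedly, and $t$ ranges over positive thresholds with $\mathbb{P}[X\le t]>0$. Profile: let $R(\alpha)=\alpha/\mathbb{P}[X\le\alpha]$ for $\alpha>0$ (with value $+\infty$ if $\mathbb{P}[X\le\alpha]=0$), and let $\tau=\arg\min_{\alpha>0}R(\alpha)$ (any minimizer). The profile of $\mathrm{alg}$ is the point $(1/p,\tau)$, where $p=\mathbb{P}[X\le\tau]$. -}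

module Defs where

open import Level using (Level; suc; Lift; lower)
open import Algebra.Bundles using (CommutativeRing)
open import Algebra.Definitions using (Invertible)
import Algebra.Definitions.RawMonoid as RawMonoidDefs
open import Axiom.ExcludedMiddle using (ExcludedMiddle)
open import Data.Bool.Base using (if_then_else_)
open import Data.Fin.Base using (Fin; toℕ)
open import Data.Nat.Base using (ℕ)
open import Data.Product.Base using (Σ; ∃; _×_; _,_; proj₁)
open import Data.Unit.Polymorphic.Base using (⊤)
open import Relation.Binary.Core using (Rel)
open import Relation.Binary.Structures using (IsDecTotalOrder)
open import Relation.Binary.PropositionalEquality.Core using (_≢_)
import Relation.Binary.Construct.NonStrictToStrict as ToStrict
import Relation.Binary.Construct.Add.Supremum.NonStrict as AddSupNonStrict
import Relation.Binary.Construct.Add.Supremum.Strict as AddSupStrict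
open import Relation.Nullary.Construct.Add.Supremum using (_⁺; [_]; ⊤⁺)
open import Relation.Nullary.Decidable.Core using (yes; no; does)
open import Relation.Nullary.Negation.Core using (¬_)
open import Relation.Unary using (Pred; Decidable; ∁; ⋃; _≐_; _⊥_)

-- A Dedekind-complete ordered field.  Classically such a structure exists and
-- is unique up to isomorphism, so a theorem about all of them is a theorem
-- about the real numbers.

record Reals (ℓ : Level) : Set (suc (suc ℓ)) where
  field
    commutativeRing : CommutativeRing ℓ ℓ

  open CommutativeRing commutativeRing public
    using (Carrier; _≈_; _+_; _*_; -_; 0#; 1#; +-rawMonoid)
  open RawMonoidDefs +-rawMonoid public using (sum)

  infix 4 _≤_
  field
    _≤_             : Rel Carrier ℓ
    isDecTotalOrder : IsDecTotalOrder _≈_ _≤_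
    +-monoˡ-≤       : ∀ {x y} z → x ≤ y → (x + z) ≤ (y + z)
    *-nonneg        : ∀ {x y} → 0# ≤ x → 0# ≤ y → 0# ≤ (x * y)
    0≉1             : ¬ (0# ≈ 1#)
    invertible      : ∀ {x} → ¬ (x ≈ 0#) → Invertible _≈_ 1# _*_ x

  open IsDecTotalOrder isDecTotalOrder public using (_≟_; _≤?_)
  open ToStrict _≈_ _≤_ public using (_<_)

  UpperBound : ∀ {i} {I : Set i} → (I → Carrier) → Carrier → Set _
  UpperBound f u = ∀ i → f i ≤ u

  IsLub : ∀ {i} {I : Set i} → (I → Carrier) → Carrier → Set _
  IsLub f x = UpperBound f x × (∀ u → UpperBound f u → x ≤ u)

  field
    complete : {I : Set (suc ℓ)} (f : I → Carrier) →
               I → ∃ (UpperBound f) → ∃ (IsLub f)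

module RunningTime {ℓ : Level} (em : ExcludedMiddle (suc ℓ)) (ℝ : Reals ℓ) where

  open Reals ℝ public
  open AddSupNonStrict _≤_ public using (_≤⁺_; ≤⁺-dec)
  open AddSupStrict _<_ public using (_<⁺_)

  -- Carrier ⁺ stands for [0,+∞], with ⊤⁺ as +∞; its elements are
  -- non-negative wherever it is used below.

  infixl 6 _+⁺_
  infixl 7 _*⁺_ _÷_

  _+⁺_ : Carrier ⁺ → Carrier ⁺ → Carrier ⁺
  [ x ] +⁺ [ y ] = [ x + y ]
  [ _ ] +⁺ ⊤⁺    = ⊤⁺
  ⊤⁺    +⁺ _     = ⊤⁺

  -- Only used with a positive left factor.
  _*⁺_ : Carrier → Carrier ⁺ → Carrier ⁺
  c *⁺ [ x ] = [ c * x ]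
  c *⁺ ⊤⁺    = ⊤⁺

  -- Division by zero gives +∞, which is the convention for R below.
  _÷_ : Carrier ⁺ → Carrier → Carrier ⁺
  ⊤⁺    ÷ y = ⊤⁺
  [ x ] ÷ y with y ≟ 0#
  ... | yes _  = ⊤⁺
  ... | no y≉0 = [ x * proj₁ (invertible y≉0) ]

  -- Supremum and infimum in [0,+∞]; in particular the supremum of the empty
  -- family is 0 and its infimum is +∞.

  ⨆ : {I : Set (suc ℓ)} → (I → Carrier) → Carrier ⁺
  ⨆ {I} f with em {I} | em {∃ (UpperBound f)}
  ... | yes i | yes bounded = [ proj₁ (complete f i bounded) ]
  ... | yes _ | no _        = ⊤⁺
  ... | no _  | _           = [ 0# ]

  ⨅ : {J : Set ℓ} → (J → Carrier ⁺) → Carrier ⁺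
  ⨅ {J} g = ⨆ {Lift (suc ℓ) LowerBound} (λ b → proj₁ (lower b))
    where
    LowerBound : Set ℓ
    LowerBound = Σ Carrier λ x → 0# ≤ x × (∀ j → [ x ] ≤⁺ g j)

  -- ℙ is a total function for convenience; its values outside the σ-algebra
  -- are unconstrained.
  record ProbabilitySpace : Set (suc (suc ℓ)) where
    field
      Ω          : Set ℓ
      Measurable : Pred Ω ℓ → Set ℓ
      respects-≐ : ∀ {A B} → A ≐ B → Measurable A → Measurable B
      ∁-closed   : ∀ {A} → Measurable A → Measurable (∁ A)
      ⋃-closed   : (A : ℕ → Pred Ω ℓ) → (∀ n → Measurable (A n)) →
                   Measurable (⋃ ℕ A)
      ℙ          : Pred Ω ℓ → Carrier
      ℙ-cong     : ∀ {A B} → Measurable A → A ≐ B → ℙ A ≈ ℙ B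
      ℙ-nonneg   : ∀ {A} → Measurable A → 0# ≤ ℙ A
      -- A series of non-negative terms converges to the supremum of its
      -- partial sums.
      ℙ-additive : (A : ℕ → Pred Ω ℓ) → (∀ n → Measurable (A n)) →
                   (∀ {m n} → m ≢ n → A m ⊥ A n) →
                   IsLub (λ n → sum {n} (λ i → ℙ (A (toℕ i)))) (ℙ (⋃ ℕ A))
      Ω-measurable : Measurable (λ _ → ⊤)
      ℙ-total      : ℙ (λ _ → ⊤) ≈ 1#

  module Integral (space : ProbabilitySpace) where
    open ProbabilitySpace space

    -- The function equal to value i on piece i, and to 0 outside all pieces.
    record Simple : Set (suc ℓ) where
      field
        size       : ℕ
        value      : Fin size → Carrier
        piece      : Fin size → Pred Ω ℓ
        nonneg     : ∀ i → 0# ≤ value i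
        measurable : ∀ i → Measurable (piece i)
        disjoint   : ∀ {i j} → i ≢ j → piece i ⊥ piece j

    open Simple

    ∫ : Simple → Carrier
    ∫ s = sum (λ i → value s i * ℙ (piece s i))

    _Below_ : Simple → (Ω → Carrier ⁺) → Set ℓ
    s Below Y = ∀ i {ω} → piece s i ω → [ value s i ] ≤⁺ Y ω

    -- Lebesgue integral of a measurable function with values in [0,+∞].
    𝔼[_] : (Ω → Carrier ⁺) → Carrier ⁺
    𝔼[ Y ] = ⨆ {∃ (_Below Y)} (λ s → ∫ (proj₁ s))

    𝔼[_∣_] : (Ω → Carrier ⁺) → {A : Pred Ω ℓ} → Decidable A → Carrier ⁺
    𝔼[_∣_] Y {A} A? = 𝔼[ (λ ω → if does (A? ω) then Y ω else [ 0# ]) ] ÷ ℙ A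

  record Algorithm : Set (suc (suc ℓ)) where
    field
      space : ProbabilitySpace

    open ProbabilitySpace space public
    open Integral space public

    field
      X : Ω → Carrier ⁺

    X≤ : Carrier → Pred Ω ℓ
    X≤ t ω = X ω ≤⁺ [ t ]

    X≤? : ∀ t → Decidable (X≤ t)
    X≤? t ω = ≤⁺-dec _≤?_ (X ω) [ t ]

    X> : Carrier → Pred Ω ℓ
    X> t ω = [ t ] <⁺ X ω

    X<∞ : Pred Ω ℓ
    X<∞ ω = X ω <⁺ ⊤⁺

    field
      X-measurable : ∀ t → Measurable (X≤ t)
      1≤X          : ∀ ω → [ 1# ] ≤⁺ X ω
      ℙ[X<∞]>0     : 0# < ℙ X<∞

    Threshold : Set ℓ
    Threshold = Σ Carrier λ t → 0# < t × 0# < ℙ (X≤ t)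

    -- Expected running time when every run is killed at t.
    f : Carrier → Carrier ⁺
    f t = 𝔼[ X ∣ X≤? t ] +⁺ t *⁺ ([ ℙ (X> t) ] ÷ ℙ (X≤ t))

    -- Repeating one fixed threshold is optimal among all simulations.
    𝒪 : Carrier ⁺
    𝒪 = ⨅ {Threshold} (λ t → f (proj₁ t))

    R : Carrier → Carrier ⁺
    R α = [ α ] ÷ ℙ (X≤ α)

    -- The profile of the algorithm is the point (1/p , τ); a profile need not
    -- be unique, as any minimizer τ of R is allowed.
    record HasProfile (p τ : Carrier) : Set ℓ where
      field
        τ>0       : 0# < τ
        minimizer : ∀ α → 0# < α → R τ ≤⁺ R α
        p≈        : p ≈ ℙ (X≤ τ)

{-# OPTIONS --safe #-}

-- Write q(t) = ℙ[X ≤ t], p = q(τ) and m = R(τ) = τ/p.  Multiplying by q(t) turns f(t)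
-- into 𝔼[X ; X ≤ t] + t ℙ[X > t] = 𝔼[min(X , t)].
-- Upper bound: 𝔼[min(X , τ)] ≤ τ, so 𝒪 ≤ f(τ) ≤ τ/p.
-- Lower bound: minimality of τ says q(α) m ≤ α for every α > 0.  With α = q(t) m / 2
-- this gives α ≤ t and q(α) ≤ 1/2, so by Markov's inequality
-- 𝔼[min(X , t)] ≥ α ℙ[X > α] ≥ q(t) m / 4, that is, f(t) ≥ m/4.

module Submission where

open import Defs
open import Level using (Level; suc; lift; lower)
open import Algebra.Bundles using (CommutativeRing)
import Algebra.Properties.Group as GroupProperties
import Algebra.Properties.Monoid.Sum as MonoidSum
import Algebra.Properties.Ring as RingProperties
import Algebra.Properties.Semiring.Sum as SemiringSum
import Algebra.Solver.Ring.NaturalCoefficients.Default as NatSolver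
open import Axiom.ExcludedMiddle using (ExcludedMiddle)
open import Data.Bool.Base using (if_then_else_)
open import Data.Empty using (⊥-elim)
import Data.Empty.Polymorphic as Poly
open import Data.Fin.Base as Fin using (Fin; toℕ)
import Data.Fin.Properties as Fin
open import Data.Nat.Base as ℕ using (ℕ)
open import Data.Product.Base using (∃; ∃₂; _×_; _,_; proj₁; proj₂)
open import Data.Sum.Base using (inj₁; inj₂)
open import Function.Base using (_∘_)
open import Relation.Binary.Bundles using (Poset)
open import Relation.Binary.Structures using (IsDecTotalOrder)
import Relation.Binary.Construct.Add.Supremum.NonStrict as AddSupNonStrict
import Relation.Binary.Construct.Add.Supremum.Strict as AddSupStrict
import Relation.Binary.Reasoning.PartialOrder as PosetReasoning
open import Relation.Binary.PropositionalEquality.Core as ≡ using (_≡_; _≢_)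
open import Relation.Nullary.Construct.Add.Supremum using (_⁺; [_]; ⊤⁺)
open import Relation.Nullary.Decidable.Core using (Dec; yes; no; does; decidable-stable)
open import Relation.Nullary.Negation.Core using (¬_; contradiction)
open import Relation.Unary using (Pred; ∁; ⋃; _≐_; _⊥_; _⊆_; _∩_; _∪_; _∖_)

-- Arithmetic in an ordered field.

module OrderedField {ℓ : Level} (ℝ : Reals ℓ) where

  open Reals ℝ
  open CommutativeRing commutativeRing public
    using (refl; sym; trans; +-cong; +-congˡ; +-congʳ; +-comm; +-assoc; +-identityʳ;
           +-identityˡ; -‿inverseʳ; *-congˡ; *-congʳ; *-comm; *-assoc;
           *-identityˡ; *-identityʳ; distribˡ; distribʳ; zeroˡ; zeroʳ;
           ring; semiring; +-group; +-monoid; commutativeSemiring)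
  open IsDecTotalOrder isDecTotalOrder public
    using (total; antisym; isPartialOrder)
    renaming (refl to ≤-refl; trans to ≤-trans; reflexive to ≤-reflexive)
  open GroupProperties +-group using (//-rightDividesˡ; ⁻¹-involutive)
  open RingProperties ring using (-1*x≈-x)
  open NatSolver commutativeSemiring public using (solve; _:=_; _:+_; _:*_)

  poset : Poset ℓ ℓ ℓ
  poset = record { isPartialOrder = isPartialOrder }

  open PosetReasoning poset public

  +-monoʳ-≤ : ∀ {x y} z → x ≤ y → z + x ≤ z + y
  +-monoʳ-≤ {x} {y} z x≤y = begin
    z + x ≈⟨ +-comm z x ⟩
    x + z ≤⟨ +-monoˡ-≤ z x≤y ⟩
    y + z ≈⟨ +-comm y z ⟩
    z + y ∎

  +-mono-≤ : ∀ {w x y z} → w ≤ x → y ≤ z → w + y ≤ x + z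
  +-mono-≤ w≤x y≤z = ≤-trans (+-monoˡ-≤ _ w≤x) (+-monoʳ-≤ _ y≤z)

  x≤x+y : ∀ {x y} → 0# ≤ y → x ≤ x + y
  x≤x+y {x} {y} 0≤y = begin
    x      ≈⟨ +-identityʳ x ⟨
    x + 0# ≤⟨ +-monoʳ-≤ x 0≤y ⟩
    x + y  ∎

  +-cancelʳ-≤ : ∀ {x y} z → x + z ≤ y + z → x ≤ y
  +-cancelʳ-≤ {x} {y} z x+z≤y+z = begin
    x              ≈⟨ cancel x ⟨
    (x + z) + - z  ≤⟨ +-monoˡ-≤ (- z) x+z≤y+z ⟩
    (y + z) + - z  ≈⟨ cancel y ⟩
    y              ∎
    where
    cancel : ∀ w → (w + z) + - z ≈ w
    cancel w = trans (+-assoc w z (- z)) (trans (+-congˡ (-‿inverseʳ z)) (+-identityʳ w))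

  -- The difference of the two sides is `(y + - x) * z`, a product of non-negative factors.
  *-monoʳ-≤ : ∀ {x y z} → 0# ≤ z → x ≤ y → x * z ≤ y * z
  *-monoʳ-≤ {x} {y} {z} 0≤z x≤y = begin
    x * z                    ≤⟨ x≤x+y (*-nonneg 0≤y-x 0≤z) ⟩
    x * z + (y + - x) * z    ≈⟨ distribʳ z x (y + - x) ⟨
    (x + (y + - x)) * z      ≈⟨ *-congʳ (trans (+-comm x _) (//-rightDividesˡ x y)) ⟩
    y * z                    ∎
    where
    0≤y-x : 0# ≤ y + - x
    0≤y-x = begin
      0#      ≈⟨ -‿inverseʳ x ⟨
      x + - x ≤⟨ +-monoˡ-≤ (- x) x≤y ⟩
      y + - x ∎

  *-monoˡ-≤ : ∀ {x y z} → 0# ≤ z → x ≤ y → z * x ≤ z * y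
  *-monoˡ-≤ {x} {y} {z} 0≤z x≤y = begin
    z * x ≈⟨ *-comm z x ⟩
    x * z ≤⟨ *-monoʳ-≤ 0≤z x≤y ⟩
    y * z ≈⟨ *-comm y z ⟩
    z * y ∎

  *⁻¹-* : ∀ x {y} (y≉0 : ¬ (y ≈ 0#)) → (x * proj₁ (invertible y≉0)) * y ≈ x
  *⁻¹-* x {y} y≉0 = trans (*-assoc x _ y)
    (trans (*-congˡ (proj₁ (proj₂ (invertible y≉0)))) (*-identityʳ x))

  *-cancelʳ : ∀ {x y z} → ¬ (z ≈ 0#) → x * z ≈ y * z → x ≈ y
  *-cancelʳ {x} {y} {z} z≉0 xz≈yz = trans (sym (cancel x)) (trans (*-congʳ xz≈yz) (cancel y))
    where
    cancel : ∀ w → (w * z) * proj₁ (invertible z≉0) ≈ w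
    cancel w = trans (*-assoc w z _)
                 (trans (*-congˡ (proj₂ (proj₂ (invertible z≉0)))) (*-identityʳ w))

  0<⇒≉0 : ∀ {x} → 0# < x → ¬ (x ≈ 0#)
  0<⇒≉0 (_ , 0≉x) x≈0 = 0≉x (sym x≈0)

  -- If instead `y ≤ x`, multiplying by `z` squeezes the two products to equality, and cancelling
  -- `z` in the field gives `x ≈ y`.
  *-cancelʳ-≤ : ∀ {x y z} → 0# < z → x * z ≤ y * z → x ≤ y
  *-cancelʳ-≤ {x} {y} 0<z xz≤yz with total x y
  ... | inj₁ x≤y = x≤y
  ... | inj₂ y≤x = ≤-reflexive
    (*-cancelʳ (0<⇒≉0 0<z) (antisym xz≤yz (*-monoʳ-≤ (proj₁ 0<z) y≤x)))

  *-pos : ∀ {x y} → 0# < x → 0# < y → 0# < x * y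
  *-pos {x} {y} (0≤x , 0≉x) (0≤y , 0≉y) =
    *-nonneg 0≤x 0≤y , λ 0≈xy → 0≉x (*-cancelʳ (0≉y ∘ sym) (trans (zeroˡ y) 0≈xy))

  -- If `1# ≤ 0#` then `- 1#` is non-negative, and `1#` is its square.
  0≤1 : 0# ≤ 1#
  0≤1 with total 0# 1#
  ... | inj₁ 0≤1 = 0≤1
  ... | inj₂ 1≤0 = begin
    0#            ≤⟨ *-nonneg 0≤-1 0≤-1 ⟩
    - 1# * - 1#   ≈⟨ -1*x≈-x (- 1#) ⟩
    - (- 1#)      ≈⟨ ⁻¹-involutive 1# ⟩
    1#            ∎
    where
    0≤-1 : 0# ≤ - 1#
    0≤-1 = begin
      0#        ≈⟨ -‿inverseʳ 1# ⟨
      1# + - 1# ≤⟨ +-monoˡ-≤ (- 1#) 1≤0 ⟩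
      0# + - 1# ≈⟨ +-identityˡ (- 1#) ⟩
      - 1#      ∎

  0<1 : 0# < 1#
  0<1 = 0≤1 , 0≉1

  0<2 : 0# < 1# + 1#
  0<2 = ≤-trans 0≤1 (x≤x+y 0≤1) ,
    λ 0≈2 → 0≉1 (antisym 0≤1 (≤-trans (x≤x+y 0≤1) (≤-reflexive (sym 0≈2))))

  ½ : Carrier
  ½ = proj₁ (invertible (0<⇒≉0 0<2))

  ½+½≈1 : ½ + ½ ≈ 1#
  ½+½≈1 = begin-equality
    ½ + ½           ≈⟨ +-cong (*-identityʳ ½) (*-identityʳ ½) ⟨
    ½ * 1# + ½ * 1# ≈⟨ distribˡ ½ 1# 1# ⟨
    ½ * (1# + 1#)   ≈⟨ proj₁ (proj₂ (invertible (0<⇒≉0 0<2))) ⟩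
    1#              ∎

  0<½ : 0# < ½
  0<½ = 0≤½ , λ 0≈½ → 0≉1 (trans (sym (+-identityˡ 0#)) (trans (+-cong 0≈½ 0≈½) ½+½≈1))
    where
    0≤½ : 0# ≤ ½
    0≤½ = *-cancelʳ-≤ 0<2 (begin
      0# * (1# + 1#) ≈⟨ zeroˡ _ ⟩
      0#             ≤⟨ 0≤1 ⟩
      1#             ≈⟨ proj₁ (proj₂ (invertible (0<⇒≉0 0<2))) ⟨
      ½ * (1# + 1#)  ∎)

  sum-mono-≤ : ∀ {n} {u v : Fin n → Carrier} → (∀ i → u i ≤ v i) → sum u ≤ sum v
  sum-mono-≤ {ℕ.zero}  u≤v = ≤-refl
  sum-mono-≤ {ℕ.suc n} u≤v = +-mono-≤ (u≤v Fin.zero) (sum-mono-≤ (u≤v ∘ Fin.suc))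

-- Order, division, suprema and infima in [0,+∞].

module ExtendedReals {ℓ : Level} (em : ExcludedMiddle (suc ℓ)) (ℝ : Reals ℓ) where

  open RunningTime em ℝ
  open OrderedField ℝ
  open AddSupNonStrict _≤_ public using ([≤]-injective; _≤⊤⁺) renaming ([_] to [_]⁺)
  open AddSupStrict _<_ public using ([_]<⊤⁺) renaming ([_] to [_]ˢ)

  ≤⁺-trans : ∀ {x y z : Carrier ⁺} → x ≤⁺ y → y ≤⁺ z → x ≤⁺ z
  ≤⁺-trans = AddSupNonStrict.≤⁺-trans _≤_ ≤-trans

  *⁺-monoʳ : ∀ {c x y} → 0# ≤ c → x ≤⁺ y → c *⁺ x ≤⁺ c *⁺ y
  *⁺-monoʳ 0≤c [ x≤y ]⁺   = [ *-monoˡ-≤ 0≤c x≤y ]⁺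
  *⁺-monoʳ 0≤c (_ ≤⊤⁺)    = _ ≤⊤⁺

  *⁺-nonneg : ∀ {c x} → 0# ≤ c → [ 0# ] ≤⁺ x → [ 0# ] ≤⁺ c *⁺ x
  *⁺-nonneg {x = [ _ ]} 0≤c [ 0≤x ]⁺ = [ *-nonneg 0≤c 0≤x ]⁺
  *⁺-nonneg {x = ⊤⁺}    _   _        = _ ≤⊤⁺

  -- Inserts the constant 1 of the upper bound.
  x≤⁺1*⁺x : ∀ x → x ≤⁺ 1# *⁺ x
  x≤⁺1*⁺x [ x ] = [ ≤-reflexive (sym (*-identityˡ x)) ]⁺
  x≤⁺1*⁺x ⊤⁺    = _ ≤⊤⁺

  ÷-zero : ∀ {x y} → y ≈ 0# → [ x ] ÷ y ≡ ⊤⁺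
  ÷-zero {y = y} y≈0 with y ≟ 0#
  ... | yes _  = ≡.refl
  ... | no y≉0 = contradiction y≈0 y≉0

  -- Division unfolds only after deciding `y ≟ 0#`. This packages the finite case as a number `z`
  -- known through `z * y ≈ x`.
  ÷-nonzero : ∀ {x y} → ¬ (y ≈ 0#) → ∃ λ z → [ x ] ÷ y ≡ [ z ] × z * y ≈ x
  ÷-nonzero {x} {y} y≉0 with y ≟ 0#
  ... | yes y≈0 = contradiction y≈0 y≉0
  ... | no y≉0′ = _ , ≡.refl , *⁻¹-* x y≉0′

  ÷-nonneg : ∀ {x y} → 0# ≤ x → 0# ≤ y → [ 0# ] ≤⁺ [ x ] ÷ y
  ÷-nonneg {x} {y} 0≤x 0≤y with y ≟ 0#
  ... | yes _  = _ ≤⊤⁺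
  ... | no y≉0 = [ *-cancelʳ-≤ (0≤y , y≉0 ∘ sym) (begin
    0# * y                             ≈⟨ zeroˡ y ⟩
    0#                                 ≤⟨ 0≤x ⟩
    x                                  ≈⟨ *⁻¹-* x y≉0 ⟨
    (x * proj₁ (invertible y≉0)) * y   ∎) ]⁺

  -- Stated as an inequality because `≈` between denominators gives quotients equal only up to `≈`,
  -- not `≡`. Symmetry of `≈` supplies the other direction.
  ÷-congʳ : ∀ {x y y′} → y ≈ y′ → [ x ] ÷ y ≤⁺ [ x ] ÷ y′
  ÷-congʳ {x} {y} {y′} y≈y′ with y′ ≟ 0#
  ... | yes _   = _ ≤⊤⁺
  ... | no y′≉0 with ÷-nonzero {x} {y} (y′≉0 ∘ trans (sym y≈y′))
  ...   | z , eq , zy≈x rewrite eq =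
    [ ≤-reflexive (*-cancelʳ y′≉0 (trans (*-congˡ (sym y≈y′)) (trans zy≈x (sym (*⁻¹-* x y′≉0))))) ]⁺

  -- If `y` is zero the quotient is +∞ and the left side of the conclusion vanishes. Minimality of
  -- `R` can thus be applied even at points where the probability is zero.
  ≤⁺÷⇒*≤ : ∀ {z x y} → 0# ≤ x → 0# ≤ y → [ z ] ≤⁺ [ x ] ÷ y → z * y ≤ x
  ≤⁺÷⇒*≤ {z} {x} {y} 0≤x 0≤y z≤x÷y with y ≟ 0#
  ... | yes y≈0 = begin
    z * y  ≈⟨ *-congˡ y≈0 ⟩
    z * 0# ≈⟨ zeroʳ z ⟩
    0#     ≤⟨ 0≤x ⟩
    x      ∎
  ... | no y≉0 = begin
    z * y                               ≤⟨ *-monoʳ-≤ 0≤y ([≤]-injective z≤x÷y) ⟩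
    (x * proj₁ (invertible y≉0)) * y    ≈⟨ *⁻¹-* x y≉0 ⟩
    x                                   ∎

  ⨆-upper : {I : Set (suc ℓ)} (u : I → Carrier) → ∀ i → [ u i ] ≤⁺ ⨆ u
  ⨆-upper {I} u i with em {I} | em {∃ (UpperBound u)}
  ... | yes j | yes bounded = [ proj₁ (proj₂ (complete u j bounded)) i ]⁺
  ... | yes _ | no _        = _ ≤⊤⁺
  ... | no ¬i | _           = contradiction i ¬i

  -- The bound `[ 0# ] ≤⁺ y` handles the empty family, whose supremum is 0.
  ⨆-least : {I : Set (suc ℓ)} (u : I → Carrier) {y : Carrier ⁺} →
            [ 0# ] ≤⁺ y → (∀ i → [ u i ] ≤⁺ y) → ⨆ u ≤⁺ y
  ⨆-least u {⊤⁺} _ _ = _ ≤⊤⁺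
  ⨆-least {I} u {[ y ]} 0≤y u≤y with em {I} | em {∃ (UpperBound u)}
  ... | yes j | yes bounded  =
    [ proj₂ (proj₂ (complete u j bounded)) y ([≤]-injective ∘ u≤y) ]⁺
  ... | yes _ | no unbounded = contradiction (y , [≤]-injective ∘ u≤y) unbounded
  ... | no _  | _            = 0≤y

  ⨅-lower : {J : Set ℓ} (g : J → Carrier ⁺) → ∀ j → [ 0# ] ≤⁺ g j → ⨅ g ≤⁺ g j
  ⨅-lower g j 0≤gj = ⨆-least _ 0≤gj (λ b → proj₂ (proj₂ (lower b)) j)

  ⨅-greatest : {J : Set ℓ} (g : J → Carrier ⁺) {x : Carrier ⁺} →
               [ 0# ] ≤⁺ x → (∀ j → x ≤⁺ g j) → x ≤⁺ ⨅ g
  ⨅-greatest g {[ x ]} [ 0≤x ]⁺ x≤g = ⨆-upper _ (lift (x , 0≤x , x≤g))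
  -- By the previous clause every non-negative real lies below the infimum, so a finite infimum `y`
  -- would satisfy `1# + y ≤ y`.
  ⨅-greatest g {⊤⁺} _ ⊤≤g
    with ⨅ g | (λ x 0≤x → ⨅-greatest g {[ x ]} [ 0≤x ]⁺ (λ j → ≤⁺-trans (_ ≤⊤⁺) (⊤≤g j)))
  ... | ⊤⁺    | _ = _ ≤⊤⁺
  ... | [ y ] | all≤y =
    contradiction (antisym 0≤1 (+-cancelʳ-≤ y (≤-trans 1+y≤y (≤-reflexive (sym (+-identityˡ y)))))) 0≉1
    where
    1+y≤y : 1# + y ≤ y
    1+y≤y = [≤]-injective (all≤y (1# + y) (≤-trans 0≤1 (x≤x+y ([≤]-injective (all≤y 0# ≤-refl)))))

  -- E ÷ q +⁺ t *⁺ ([ r ] ÷ q) is the shape of f t, bounded here after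
  -- multiplication by q = ℙ[X ≤ t].
  killed-≤ : ∀ {E e q r t m} → 0# < q → E ≤⁺ [ e ] → e + t * r ≤ m * q →
             E ÷ q +⁺ t *⁺ ([ r ] ÷ q) ≤⁺ [ m ]
  killed-≤ {[ e′ ]} {e} {q} {r} {t} {m} 0<q [ e′≤e ]⁺ e+tr≤mq
    with ÷-nonzero {e′} {q} (0<⇒≉0 0<q) | ÷-nonzero {r} {q} (0<⇒≉0 0<q)
  ... | u , eq₁ , uq≈e′ | w , eq₂ , wq≈r rewrite eq₁ | eq₂ = [ *-cancelʳ-≤ 0<q (begin
    (u + t * w) * q     ≈⟨ solve 4 (λ u t w q → (u :+ t :* w) :* q := u :* q :+ t :* (w :* q))
                             refl u t w q ⟩
    u * q + t * (w * q) ≈⟨ +-cong uq≈e′ (*-congˡ wq≈r) ⟩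
    e′ + t * r          ≤⟨ +-monoˡ-≤ _ e′≤e ⟩
    e + t * r           ≤⟨ e+tr≤mq ⟩
    m * q               ∎) ]⁺

  ≤-killed : ∀ {E e q r t m} → 0# < q → [ e ] ≤⁺ E → m * q ≤ e + t * r →
             [ m ] ≤⁺ E ÷ q +⁺ t *⁺ ([ r ] ÷ q)
  ≤-killed {⊤⁺} _ _ _ = _ ≤⊤⁺
  ≤-killed {[ e′ ]} {e} {q} {r} {t} {m} 0<q [ e≤e′ ]⁺ mq≤e+tr
    with ÷-nonzero {e′} {q} (0<⇒≉0 0<q) | ÷-nonzero {r} {q} (0<⇒≉0 0<q)
  ... | u , eq₁ , uq≈e′ | w , eq₂ , wq≈r rewrite eq₁ | eq₂ = [ *-cancelʳ-≤ 0<q (begin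
    m * q               ≤⟨ mq≤e+tr ⟩
    e + t * r           ≤⟨ +-monoˡ-≤ _ e≤e′ ⟩
    e′ + t * r          ≈⟨ +-cong uq≈e′ (*-congˡ wq≈r) ⟨
    u * q + t * (w * q) ≈⟨ solve 4 (λ u t w q → (u :+ t :* w) :* q := u :* q :+ t :* (w :* q))
                             refl u t w q ⟨
    (u + t * w) * q     ∎) ]⁺

-- Finite additivity and monotonicity of probability.

module Measure {ℓ : Level} (em : ExcludedMiddle (suc ℓ)) (ℝ : Reals ℓ)
               (space : RunningTime.ProbabilitySpace em ℝ) where

  open RunningTime em ℝ
  open OrderedField ℝ
  open ExtendedReals em ℝ
  open ProbabilitySpace space
  open Integral space
  open MonoidSum +-monoid using (sum-cong-≋; sum-replicate-zero)
  open SemiringSum semiring using (*-distribˡ-sum)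

  private
    variable
      A B : Pred Ω ℓ

  -- Excluded middle is given at level `suc ℓ`, so `P` is lifted to reach it.
  dne : {P : Set ℓ} → ¬ ¬ P → P
  dne ¬¬p = lower (decidable-stable em (λ ¬p → ¬¬p (¬p ∘ lift)))

  ∅ : Pred Ω ℓ
  ∅ _ = Poly.⊥

  -- Padding with empty sets turns the countable axioms into their two-set forms.
  pair : Pred Ω ℓ → Pred Ω ℓ → ℕ → Pred Ω ℓ
  pair A B 0                   = A
  pair A B 1                   = B
  pair A B (ℕ.suc (ℕ.suc _))   = ∅

  ⋃-pair : ⋃ ℕ (pair A B) ≐ A ∪ B
  ⋃-pair = (λ { (0 , a) → inj₁ a ; (1 , b) → inj₂ b })
         , (λ { (inj₁ a) → 0 , a ; (inj₂ b) → 1 , b })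

  ∅-measurable : Measurable ∅
  ∅-measurable = respects-≐ ((λ ¬⊤ → ⊥-elim (¬⊤ _)) , (λ ())) (∁-closed Ω-measurable)

  pair-measurable : Measurable A → Measurable B → ∀ n → Measurable (pair A B n)
  pair-measurable mA mB 0                 = mA
  pair-measurable mA mB 1                 = mB
  pair-measurable mA mB (ℕ.suc (ℕ.suc _)) = ∅-measurable

  ∪-measurable : Measurable A → Measurable B → Measurable (A ∪ B)
  ∪-measurable mA mB = respects-≐ ⋃-pair (⋃-closed _ (pair-measurable mA mB))

  -- De Morgan's law; leaving the double complement is classical.
  ∩-measurable : Measurable A → Measurable B → Measurable (A ∩ B)
  ∩-measurable mA mB = respects-≐
    ( (λ ¬∪ → dne (¬∪ ∘ inj₁) , dne (¬∪ ∘ inj₂))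
    , (λ { (a , _) (inj₁ ¬a) → ¬a a ; (_ , b) (inj₂ ¬b) → ¬b b }))
    (∁-closed (∪-measurable (∁-closed mA) (∁-closed mB)))

  ∖-measurable : Measurable A → Measurable B → Measurable (A ∖ B)
  ∖-measurable mA mB = ∩-measurable mA (∁-closed mB)

  -- The constant sequence `∅` is disjoint with union `∅`, so its partial sum of two terms gives
  -- `ℙ ∅ + ℙ ∅ ≤ ℙ ∅`.
  ℙ-∅ : ℙ ∅ ≈ 0#
  ℙ-∅ = antisym (+-cancelʳ-≤ (ℙ ∅) (begin
    ℙ ∅ + ℙ ∅          ≈⟨ +-congˡ (+-identityʳ (ℙ ∅)) ⟨
    ℙ ∅ + (ℙ ∅ + 0#)   ≤⟨ proj₁ (ℙ-additive (λ _ → ∅) (λ _ → ∅-measurable) (λ _ ())) 2 ⟩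
    ℙ (⋃ ℕ (λ _ → ∅))  ≈⟨ ℙ-cong (⋃-closed _ (λ _ → ∅-measurable)) ((λ ()) , (λ ())) ⟩
    ℙ ∅                ≈⟨ +-identityˡ (ℙ ∅) ⟨
    0# + ℙ ∅           ∎)) (ℙ-nonneg ∅-measurable)

  -- The partial sums for the padded sequence stay at `ℙ A + ℙ B` from two terms on, so this is
  -- their supremum.
  ℙ-∪ : Measurable A → Measurable B → A ⊥ B → ℙ (A ∪ B) ≈ ℙ A + ℙ B
  ℙ-∪ {A} {B} mA mB A⊥B = begin-equality
    ℙ (A ∪ B)         ≈⟨ ℙ-cong (⋃-closed _ (pair-measurable mA mB)) ⋃-pair ⟨
    ℙ (⋃ ℕ (pair A B)) ≈⟨ antisym (proj₂ lub _ partial≤) (≤-trans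
                           (≤-reflexive (sym (+-congˡ (+-identityʳ (ℙ B))))) (proj₁ lub 2)) ⟩
    ℙ A + ℙ B         ∎
    where
    disjoint : ∀ {m n} → m ≢ n → pair A B m ⊥ pair A B n
    disjoint {0} {0} m≢n _                        = contradiction ≡.refl m≢n
    disjoint {0} {1} _ a,b                        = A⊥B a,b
    disjoint {1} {0} _ (b , a)                    = A⊥B (a , b)
    disjoint {1} {1} m≢n _                        = contradiction ≡.refl m≢n
    disjoint {_} {ℕ.suc (ℕ.suc _)} _ (_ , ())
    disjoint {ℕ.suc (ℕ.suc _)} {_} _ (() , _)

    lub : IsLub (λ n → sum {n} (λ i → ℙ (pair A B (toℕ i)))) (ℙ (⋃ ℕ (pair A B)))
    lub = ℙ-additive (pair A B) (pair-measurable mA mB) disjoint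

    partial≤ : ∀ n → sum {n} (λ i → ℙ (pair A B (toℕ i))) ≤ ℙ A + ℙ B
    partial≤ 0 = ≤-trans (ℙ-nonneg mA) (x≤x+y (ℙ-nonneg mB))
    partial≤ 1 = +-monoʳ-≤ (ℙ A) (ℙ-nonneg mB)
    partial≤ (ℕ.suc (ℕ.suc n)) = ≤-reflexive (+-congˡ (trans
      (+-congˡ (trans (sum-cong-≋ {n} (λ _ → ℙ-∅)) (sum-replicate-zero n)))
      (+-identityʳ (ℙ B))))

  ℙ-∖ : Measurable A → Measurable B → A ⊆ B → ℙ A + ℙ (B ∖ A) ≈ ℙ B
  ℙ-∖ {A} {B} mA mB A⊆B = begin-equality
    ℙ A + ℙ (B ∖ A)   ≈⟨ ℙ-∪ mA (∖-measurable mB mA) (λ { (a , _ , ¬a) → ⊥-elim (¬a a) }) ⟨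
    ℙ (A ∪ (B ∖ A))   ≈⟨ ℙ-cong mB (split , λ { (inj₁ a) → A⊆B a ; (inj₂ (b , _)) → b }) ⟨
    ℙ B               ∎
    where
    split : B ⊆ A ∪ (B ∖ A)
    split b = dne (λ ¬∪ → ¬∪ (inj₂ (b , ¬∪ ∘ inj₁)))

  ℙ-∁ : Measurable A → ℙ A + ℙ (∁ A) ≈ 1#
  ℙ-∁ {A} mA = begin-equality
    ℙ A + ℙ (∁ A)       ≈⟨ +-congˡ (ℙ-cong (∁-closed mA) ((λ ¬a → _ , ¬a) , proj₂)) ⟩
    ℙ A + ℙ (_ ∖ A)     ≈⟨ ℙ-∖ mA Ω-measurable _ ⟩
    ℙ _                 ≈⟨ ℙ-total ⟩
    1#                  ∎

  ℙ-mono : Measurable A → Measurable B → A ⊆ B → ℙ A ≤ ℙ B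
  ℙ-mono mA mB A⊆B =
    ≤-trans (x≤x+y (ℙ-nonneg (∖-measurable mB mA))) (≤-reflexive (ℙ-∖ mA mB A⊆B))

  -- Induction on the number of pieces: the later ones avoid the first, so they lie in `B` with the
  -- first piece removed.
  sum-ℙ≤ : ∀ {n} (P : Fin n → Pred Ω ℓ) → (∀ i → Measurable (P i)) →
           (∀ {i j} → i ≢ j → P i ⊥ P j) → Measurable B → (∀ i → P i ⊆ B) →
           sum (λ i → ℙ (P i)) ≤ ℙ B
  sum-ℙ≤ {n = ℕ.zero} P _ _ mB _ = ℙ-nonneg mB
  sum-ℙ≤ {B} {n = ℕ.suc n} P mP disjoint mB P⊆B = begin
    ℙ P₀ + sum (λ i → ℙ (P (Fin.suc i))) ≤⟨ +-monoʳ-≤ (ℙ P₀) (sum-ℙ≤ (P ∘ Fin.suc) (mP ∘ Fin.suc)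
      (λ i≢j → disjoint (i≢j ∘ Fin.suc-injective)) (∖-measurable mB (mP Fin.zero))
      (λ i p → P⊆B (Fin.suc i) p , λ p₀ → ⊥-elim (disjoint (λ ()) (p₀ , p)))) ⟩
    ℙ P₀ + ℙ (B ∖ P₀)                    ≈⟨ ℙ-∖ (mP Fin.zero) mB (P⊆B Fin.zero) ⟩
    ℙ B                                  ∎
    where
    P₀ = P Fin.zero

  -- Elementary bounds for the Lebesgue integral.

  𝔼-nonneg : ∀ Y → [ 0# ] ≤⁺ 𝔼[ Y ]
  -- The simple function without pieces lies below every `Y` and has integral 0.
  𝔼-nonneg Y = ⨆-upper _ (record
    { size       = 0
    ; value      = λ ()
    ; piece      = λ ()
    ; nonneg     = λ ()
    ; measurable = λ ()
    ; disjoint   = λ {i} → contradiction i λ ()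
    } , λ ())

  -- The function equal to `c` on `A` and 0 elsewhere is simple and lies below `Y`.
  markov : ∀ {c Y} → 0# ≤ c → Measurable A → (∀ {ω} → A ω → [ c ] ≤⁺ Y ω) →
           [ c * ℙ A ] ≤⁺ 𝔼[ Y ]
  markov {A} {c} 0≤c mA c≤Y = ≤⁺-trans [ ≤-reflexive (sym (+-identityʳ _)) ]⁺ (⨆-upper _ (record
    { size       = 1
    ; value      = λ _ → c
    ; piece      = λ _ → A
    ; nonneg     = λ _ → 0≤c
    ; measurable = λ _ → mA
    ; disjoint   = λ { {Fin.zero} {Fin.zero} i≢i → contradiction ≡.refl i≢i }
    } , λ _ {_} → c≤Y))

  -- It suffices to bound each simple function below `Y`. Its pieces, cut down to `B`, are disjoint
  -- subsets of `B`, and each contributes at most `c` times the probability of the cut piece.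
  𝔼-≤ : ∀ {c Y} → 0# ≤ c → Measurable B → (∀ ω → Y ω ≤⁺ [ c ]) →
        (∀ {ω} → ¬ B ω → Y ω ≤⁺ [ 0# ]) → 𝔼[ Y ] ≤⁺ [ c * ℙ B ]
  𝔼-≤ {B} {c} {Y} 0≤c mB Y≤c Y≤0 =
    ⨆-least _ [ *-nonneg 0≤c (ℙ-nonneg mB) ]⁺ (λ (s , s≤Y) → [ bound s s≤Y ]⁺)
    where
    module _ (s : Simple) (s≤Y : s Below Y) where
      open Simple s

      term : ∀ i → value i * ℙ (piece i) ≤ c * ℙ (piece i ∩ B)
      term i with value i ≤? 0#
      ... | yes v≤0 = begin
        value i * ℙ (piece i)   ≤⟨ *-monoʳ-≤ (ℙ-nonneg (measurable i)) v≤0 ⟩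
        0# * ℙ (piece i)        ≈⟨ zeroˡ _ ⟩
        0#                      ≤⟨ *-nonneg 0≤c (ℙ-nonneg (∩-measurable (measurable i) mB)) ⟩
        c * ℙ (piece i ∩ B)     ∎
      -- A positive value confines its piece to `B`, since `Y` is at most 0 outside `B`.
      ... | no v≰0 with value i ≤? c
      ...   | yes v≤c = begin
        value i * ℙ (piece i)   ≤⟨ *-monoʳ-≤ (ℙ-nonneg (measurable i)) v≤c ⟩
        c * ℙ (piece i)         ≤⟨ *-monoˡ-≤ 0≤c (ℙ-mono (measurable i) (∩-measurable (measurable i) mB)
                                     (λ p → p , dne (λ ¬b →
                                       v≰0 ([≤]-injective (≤⁺-trans (s≤Y i p) (Y≤0 ¬b)))))) ⟩
        c * ℙ (piece i ∩ B)     ∎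
      -- A value above `c` forces the piece to be empty, since `Y` never exceeds `c`.
      ...   | no v≰c = begin
        value i * ℙ (piece i)   ≈⟨ *-congˡ (ℙ-cong (measurable i)
                                     ((λ p → contradiction ([≤]-injective (≤⁺-trans (s≤Y i p) (Y≤c _))) v≰c)
                                     , λ ())) ⟩
        value i * ℙ ∅           ≈⟨ trans (*-congˡ ℙ-∅) (zeroʳ _) ⟩
        0#                      ≤⟨ *-nonneg 0≤c (ℙ-nonneg (∩-measurable (measurable i) mB)) ⟩
        c * ℙ (piece i ∩ B)     ∎

      bound : ∫ s ≤ c * ℙ B
      bound = begin
        ∫ s                                    ≤⟨ sum-mono-≤ term ⟩
        sum (λ i → c * ℙ (piece i ∩ B))        ≈⟨ *-distribˡ-sum c (λ i → ℙ (piece i ∩ B)) ⟨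
        c * sum (λ i → ℙ (piece i ∩ B))        ≤⟨ *-monoˡ-≤ 0≤c (sum-ℙ≤ _
          (λ i → ∩-measurable (measurable i) mB)
          (λ i≢j ((p , _) , (p′ , _)) → disjoint i≢j (p , p′)) mB (λ _ → proj₂)) ⟩
        c * ℙ B                                ∎

-- Expected cost of a run killed at a threshold.

module Bounds {ℓ : Level} (em : ExcludedMiddle (suc ℓ)) (ℝ : Reals ℓ)
              (alg : RunningTime.Algorithm em ℝ) where

  open RunningTime em ℝ
  open OrderedField ℝ
  open ExtendedReals em ℝ
  open Algorithm alg
  open Measure em ℝ space

  q : Carrier → Carrier
  q t = ℙ (X≤ t)

  -- The integrand in the numerator of `𝔼[ X ∣ X≤? t ]`.
  X∣≤ : Carrier → Ω → Carrier ⁺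
  X∣≤ t ω = if does (X≤? t ω) then X ω else [ 0# ]

  q≥0 : ∀ t → 0# ≤ q t
  q≥0 t = ℙ-nonneg (X-measurable t)

  ≤⁺⇒≯⁺ : ∀ {x : Carrier ⁺} {t} → x ≤⁺ [ t ] → ¬ ([ t ] <⁺ x)
  ≤⁺⇒≯⁺ [ x≤t ]⁺ [ t≤x , t≉x ]ˢ = t≉x (antisym t≤x x≤t)

  ≰⁺⇒>⁺ : ∀ {x : Carrier ⁺} {t} → ¬ (x ≤⁺ [ t ]) → [ t ] <⁺ x
  ≰⁺⇒>⁺ {⊤⁺}    _   = [ _ ]<⊤⁺
  ≰⁺⇒>⁺ {[ x ]} {t} x≰t with total t x
  ... | inj₁ t≤x = [ t≤x , (λ t≈x → x≰t [ ≤-reflexive (sym t≈x) ]⁺) ]ˢ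
  ... | inj₂ x≤t = contradiction [ x≤t ]⁺ x≰t

  ∁X≤≐X> : ∀ t → ∁ (X≤ t) ≐ X> t
  ∁X≤≐X> t = ≰⁺⇒>⁺ , λ t<x x≤t → ≤⁺⇒≯⁺ x≤t t<x

  q+ℙ[X>]≈1 : ∀ t → q t + ℙ (X> t) ≈ 1#
  q+ℙ[X>]≈1 t = trans
    (+-congˡ (sym (ℙ-cong (∁-closed (X-measurable t)) (∁X≤≐X> t)))) (ℙ-∁ (X-measurable t))

  ℙ[X>]≥0 : ∀ t → 0# ≤ ℙ (X> t)
  ℙ[X>]≥0 t = ℙ-nonneg (respects-≐ (∁X≤≐X> t) (∁-closed (X-measurable t)))

  q≤1 : ∀ t → q t ≤ 1#
  q≤1 t = ≤-trans (x≤x+y (ℙ[X>]≥0 t)) (≤-reflexive (q+ℙ[X>]≈1 t))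

  q-mono : ∀ {s t} → s ≤ t → X≤ s ⊆ X≤ t
  q-mono s≤t x≤s = ≤⁺-trans x≤s [ s≤t ]⁺

  -- Lower bounds in `⨅` range over the non-negative reals, and `⨅-lower` asks for this bound.
  0≤f : ∀ {t} → 0# < t → 0# < q t → [ 0# ] ≤⁺ f t
  0≤f {t} (0≤t , _) 0<q = ≤-killed 0<q (𝔼-nonneg _) (begin
    0# * q t            ≈⟨ zeroˡ _ ⟩
    0#                  ≤⟨ *-nonneg 0≤t (ℙ[X>]≥0 t) ⟩
    t * ℙ (X> t)        ≈⟨ +-identityˡ _ ⟨
    0# + t * ℙ (X> t)   ∎)

  𝔼X∣≤-upper : ∀ {t} → 0# ≤ t → 𝔼[ X∣≤ t ] ≤⁺ [ t * q t ]
  𝔼X∣≤-upper {t} 0≤t = 𝔼-≤ 0≤t (X-measurable t) X∣≤t≤t X∣≤t≤0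
    where
    X∣≤t≤t : ∀ ω → X∣≤ t ω ≤⁺ [ t ]
    X∣≤t≤t ω with X≤? t ω
    ... | yes x≤t = x≤t
    ... | no _    = [ 0≤t ]⁺

    X∣≤t≤0 : ∀ {ω} → ¬ X≤ t ω → X∣≤ t ω ≤⁺ [ 0# ]
    X∣≤t≤0 {ω} x≰t with X≤? t ω
    ... | yes x≤t = contradiction x≤t x≰t
    ... | no _    = [ ≤-refl ]⁺

  -- Markov's inequality on the event s < X ≤ t. The runs with X > t are charged to the killing term
  -- of `f t`.
  𝔼X∣≤-lower : ∀ {s t} → 0# ≤ s → [ s * ℙ (X≤ t ∖ X≤ s) ] ≤⁺ 𝔼[ X∣≤ t ]
  𝔼X∣≤-lower {s} {t} 0≤s =
    markov 0≤s (∖-measurable (X-measurable t) (X-measurable s)) s≤X∣≤t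
    where
    s≤X∣≤t : ∀ {ω} → (X≤ t ∖ X≤ s) ω → [ s ] ≤⁺ X∣≤ t ω
    s≤X∣≤t {ω} (x≤t , x≰s) with X≤? t ω
    ... | no x≰t = contradiction x≤t x≰t
    ... | yes _  with X ω | ≰⁺⇒>⁺ x≰s
    ...   | _ | [ s≤x , _ ]ˢ = [ s≤x ]⁺
    ...   | _ | [ _ ]<⊤⁺     = _ ≤⊤⁺

  -- A run, finished or killed, costs at most `t`, and the probabilities of the two outcomes sum to
  -- 1.
  f≤R : ∀ {t} → 0# < t → 0# < q t → f t ≤⁺ R t
  f≤R {t} (0≤t , _) 0<q with ÷-nonzero {t} (0<⇒≉0 0<q)
  ... | m , eq , mq≈t rewrite eq = killed-≤ 0<q (𝔼X∣≤-upper 0≤t) (begin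
    t * q t + t * ℙ (X> t)  ≈⟨ distribˡ t _ _ ⟨
    t * (q t + ℙ (X> t))    ≈⟨ trans (*-congˡ (q+ℙ[X>]≈1 t)) (*-identityʳ t) ⟩
    t                       ≈⟨ mq≈t ⟨
    m * q t                 ∎)

  -- The two bounds at a minimizer of `R`.

  module _ {τ : Carrier} (0<τ : 0# < τ) (minimizer : ∀ α → 0# < α → R τ ≤⁺ R α) where

    𝒪≤R : 𝒪 ≤⁺ R τ
    𝒪≤R = helper (q τ ≟ 0#)
      where
      helper : Dec (q τ ≈ 0#) → 𝒪 ≤⁺ R τ
      -- Here `τ` is not an admissible threshold, but `R τ` is +∞.
      helper (yes q≈0) rewrite ÷-zero {τ} q≈0 = _ ≤⊤⁺
      helper (no q≉0) = ≤⁺-trans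
        (⨅-lower {Threshold} (f ∘ proj₁) (τ , 0<τ , 0<q) (0≤f 0<τ 0<q)) (f≤R 0<τ 0<q)
        where
        0<q : 0# < q τ
        0<q = q≥0 τ , q≉0 ∘ sym

    -- At least half of the probability lies above the level `α`. Runs there cost at least `α`:
    -- those counted by `b` finish after `α`, and those counted by `r` are killed at `t`, which is
    -- at least `α`.
    ¼m≤f : ∀ {m t} → m * q τ ≈ τ → R τ ≡ [ m ] → 0# < q τ → 0# < t → 0# < q t →
           [ (½ * ½) * m ] ≤⁺ f t
    ¼m≤f {m} {t} mq≈τ Rτ≡m 0<qτ 0<t 0<q = ≤-killed 0<q (𝔼X∣≤-lower (proj₁ 0<α)) (begin
      -- One factor `½` is absorbed into `α`; the other is the lower bound for `b + r`.
      ((½ * ½) * m) * q t       ≈⟨ solve 3 (λ h m q → ((h :* h) :* m) :* q := ((h :* m) :* q) :* h)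
                                     refl ½ m (q t) ⟩
      α * ½                     ≤⟨ *-monoˡ-≤ (proj₁ 0<α) ½≤b+r ⟩
      α * (b + r)               ≈⟨ distribˡ α b r ⟩
      α * b + α * r             ≤⟨ +-monoʳ-≤ _ (*-monoʳ-≤ (ℙ[X>]≥0 t) α≤t) ⟩
      α * b + t * r             ∎)
      where
      0<m : 0# < m
      0<m = *-cancelʳ-≤ 0<qτ (begin
          0# * q τ  ≈⟨ zeroˡ _ ⟩
          0#        ≤⟨ proj₁ 0<τ ⟩
          τ         ≈⟨ mq≈τ ⟨
          m * q τ   ∎)
        , λ 0≈m → proj₂ 0<τ (trans (sym (zeroˡ (q τ))) (trans (*-congʳ 0≈m) mq≈τ))

      α b r : Carrier
      -- Minimality at `α` bounds `m * q α` by `(½ * m) * q t`, and `q t ≤ 1#` turns this into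
      -- `q α ≤ ½`.
      α = (½ * m) * q t
      b = ℙ (X≤ t ∖ X≤ α)
      r = ℙ (X> t)

      0<α : 0# < α
      0<α = *-pos (*-pos 0<½ 0<m) 0<q

      -- Minimality of `R τ` with the denominator cleared.
      mq≤ : ∀ {s} → 0# < s → m * q s ≤ s
      mq≤ {s} 0<s =
        ≤⁺÷⇒*≤ (proj₁ 0<s) (q≥0 s) (≡.subst (_≤⁺ R s) Rτ≡m (minimizer s 0<s))

      α≤t : α ≤ t
      α≤t = begin
        (½ * m) * q t               ≤⟨ x≤x+y (proj₁ 0<α) ⟩
        α + α                       ≈⟨ solve 3 (λ h m q → (h :* m) :* q :+ (h :* m) :* q
                                         := (h :+ h) :* (m :* q)) refl ½ m (q t) ⟩
        (½ + ½) * (m * q t)         ≈⟨ trans (*-congʳ ½+½≈1) (*-identityˡ _) ⟩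
        m * q t                     ≤⟨ mq≤ 0<t ⟩
        t                           ∎

      qα≤½ : q α ≤ ½
      qα≤½ = *-cancelʳ-≤ 0<m (begin
        q α * m       ≈⟨ *-comm _ m ⟩
        m * q α       ≤⟨ mq≤ 0<α ⟩
        (½ * m) * q t ≤⟨ *-monoˡ-≤ (proj₁ (*-pos 0<½ 0<m)) (q≤1 t) ⟩
        (½ * m) * 1#  ≈⟨ *-identityʳ _ ⟩
        ½ * m         ∎)

      -- The events X ≤ α, α < X ≤ t and X > t partition the space, and the first has probability at
      -- most 1/2.
      ½≤b+r : ½ ≤ b + r
      ½≤b+r = +-cancelʳ-≤ ½ (begin
        ½ + ½           ≈⟨ ½+½≈1 ⟩
        1#              ≈⟨ q+ℙ[X>]≈1 t ⟨
        q t + r         ≈⟨ +-congʳ (ℙ-∖ (X-measurable α) (X-measurable t) (q-mono α≤t)) ⟨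
        (q α + b) + r   ≤⟨ +-monoˡ-≤ r (+-monoˡ-≤ b qα≤½) ⟩
        (½ + b) + r     ≈⟨ solve 3 (λ h b r → (h :+ b) :+ r := (b :+ r) :+ h) refl ½ b r ⟩
        (b + r) + ½     ∎)

    ¼R≤f : ((t , _) : Threshold) → (½ * ½) *⁺ R τ ≤⁺ f t
    ¼R≤f (t , 0<t , 0<q) = helper (q τ ≟ 0#)
      where
      -- A threshold `t` has `q t` positive, so `R t` is finite, and minimality passes this on to
      -- `R τ`.
      Rτ≢⊤ : R τ ≢ ⊤⁺
      Rτ≢⊤ Rτ≡⊤ with ÷-nonzero {t} (0<⇒≉0 0<q)
      ... | _ , Rt≡z , _ with ≡.subst₂ _≤⁺_ Rτ≡⊤ Rt≡z (minimizer t 0<t)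
      ...   | ()

      helper : Dec (q τ ≈ 0#) → (½ * ½) *⁺ R τ ≤⁺ f t
      helper (yes qτ≈0) = contradiction (÷-zero qτ≈0) Rτ≢⊤
      helper (no qτ≉0) with ÷-nonzero {τ} qτ≉0
      ... | m , Rτ≡m , mq≈τ = ≡.subst (λ x → (½ * ½) *⁺ x ≤⁺ f t) (≡.sym Rτ≡m)
        (¼m≤f mq≈τ Rτ≡m (q≥0 τ , qτ≉0 ∘ sym) 0<t 0<q)

    ¼R≤𝒪 : (½ * ½) *⁺ R τ ≤⁺ 𝒪
    ¼R≤𝒪 = ⨅-greatest {Threshold} (f ∘ proj₁)
      (*⁺-nonneg (proj₁ (*-pos 0<½ 0<½)) (÷-nonneg (proj₁ 0<τ) (q≥0 τ))) ¼R≤f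

-- The estimate with constants 1/4 and 1.

lemma2p6 : ∀ {ℓ : Level} (em : ExcludedMiddle (suc ℓ)) (ℝ : Reals ℓ) →
    let open RunningTime em ℝ in
    ∃₂ λ (c₁ c₂ : Carrier) → 0# < c₁ × 0# < c₂ ×
    ((alg : Algorithm) → let open Algorithm alg in
    (p τ : Carrier) → HasProfile p τ →
    (c₁ *⁺ ([ τ ] ÷ p)) ≤⁺ 𝒪 × 𝒪 ≤⁺ (c₂ *⁺ ([ τ ] ÷ p)))
lemma2p6 em ℝ = ½ * ½ , 1# , *-pos 0<½ 0<½ , 0<1 , λ alg p τ profile →
  let open Algorithm alg
      open HasProfile profile
      open Bounds em ℝ alg
  -- The profile fixes `p` only up to `≈`, so each bound passes between `p` and the probability of X
  -- ≤ τ by `÷-congʳ`.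
  in ≤⁺-trans (*⁺-monoʳ (proj₁ (*-pos 0<½ 0<½)) (÷-congʳ p≈)) (¼R≤𝒪 τ>0 minimizer)
   , ≤⁺-trans (𝒪≤R τ>0 minimizer) (≤⁺-trans (÷-congʳ (sym p≈)) (x≤⁺1*⁺x _))
  where
  open RunningTime em ℝ
  open OrderedField ℝ
  open ExtendedReals em ℝ
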